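{- Let $\ell,r\geq 1$ and let $C_{\ell,r}$ be the double-cycle obtained from a directed cycle of length $\ell$ and a directed cycle of length $r$ by identifying one vertex of each. Then $C_{\ell,r}$ admits a boolean nilpotent function if and only if $\min(\ell,r)$ divides $\max(\ell,r)$, and every boolean nilpotent function admitted by $C_{\ell,r}$ has class $2\max(\ell,r)-1$.
   Context: A directed cycle of length $1$ is a single vertex with a loop. $C_{\ell,r}$ has $\ell+r-1$ vertices. A boolean function on a finite vertex set $V$ is a map $f:\{0,1\}^V\to\{0,1\}^V$; its (unsigned) interaction graph has an arc $(j,i)$ iff $f_i$ depends essentially on $x_j$, i.e. $f_i(a)\neq f_i(b)$ for some $a,b$ differing only in coordinate $j$. A digraph $G$ admits $f$ if the interaction graph of $f$ equals $G$. $f$ is nilpotent if $f^k$ is constant for some $k\geq 0$ ($f^0=\mathrm{id}$); the least such $k$ is its class.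
   Formalization: The equivalence is stated for (ℓ,r) ≠ (1,1): for ℓ = r = 1 the graph is a single loop, which admits only the identity and negation, neither nilpotent, although 1 divides 1. The class claim is kept for all ℓ, r ≥ 1. -}

module Defs where

open import Data.Bool.Base using (Bool)
open import Data.Fin.Base using (Fin; zero; suc; toℕ; _↑ˡ_; _↑ʳ_)
open import Data.Nat.Base using (ℕ; suc; pred; _+_; _≤_; NonZero)
open import Data.Nat.DivMod using (_%_)
open import Data.Product.Base using (_×_; ∃; ∃₂)
open import Data.Sum.Base using (_⊎_)
open import Data.Vec.Base using (Vec; lookup)
open import Function.Bundles using (_⇔_)
open import Level using (0ℓ)
open import Relation.Binary.Core using (Rel)
open import Relation.Binary.PropositionalEquality.Core using (_≡_; _≢_)
import Function.Endo.Propositional as Endo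

-- G j i means that (j , i) is an arc of G. Loops are allowed, parallel
-- arcs are not.
Digraph : ℕ → Set₁
Digraph n = Rel (Fin n) 0ℓ

-- For ℓ = 1 this is a single vertex with a loop.
Cycle : (ℓ : ℕ) .{{_ : NonZero ℓ}} → Digraph ℓ
Cycle ℓ i j = toℕ j ≡ suc (toℕ i) % ℓ

-- The ℓ + r - 1 vertices of the double-cycle are the ℓ vertices of the
-- left cycle followed by the r - 1 nonzero vertices of the right cycle;
-- vertex 0 of the right cycle is identified with vertex 0 of the left one.
left : (ℓ r : ℕ) → Fin ℓ → Fin (ℓ + pred r)
left ℓ r i = i ↑ˡ pred r

right : (ℓ r : ℕ) .{{_ : NonZero ℓ}} → Fin r → Fin (ℓ + pred r)
right (suc ℓ) (suc r) zero    = zero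
right (suc ℓ) (suc r) (suc j) = suc ℓ ↑ʳ j

DoubleCycle : (ℓ r : ℕ) .{{_ : NonZero ℓ}} .{{_ : NonZero r}} →
              Digraph (ℓ + pred r)
DoubleCycle ℓ r u v =
    (∃₂ λ i j → Cycle ℓ i j × u ≡ left ℓ r i × v ≡ left ℓ r j)
  ⊎ (∃₂ λ i j → Cycle r i j × u ≡ right ℓ r i × v ≡ right ℓ r j)

BooleanFunction : ℕ → Set
BooleanFunction n = Vec Bool n → Vec Bool n

DifferOnlyAt : ∀ {n} → Fin n → Vec Bool n → Vec Bool n → Set
DifferOnlyAt j a b =
  lookup a j ≢ lookup b j × (∀ k → k ≢ j → lookup a k ≡ lookup b k)

InteractionGraph : ∀ {n} → BooleanFunction n → Digraph n
InteractionGraph f j i =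
  ∃₂ λ a b → DifferOnlyAt j a b × lookup (f a) i ≢ lookup (f b) i

Admits : ∀ {n} → Digraph n → BooleanFunction n → Set
Admits G f = ∀ j i → G j i ⇔ InteractionGraph f j i

Constant : ∀ {n} → BooleanFunction n → Set
Constant f = ∃ λ c → ∀ x → f x ≡ c

infixr 8 _^_

_^_ : ∀ {n} → BooleanFunction n → ℕ → BooleanFunction n
_^_ {n} = Endo._^_ (Vec Bool n)

Nilpotent : ∀ {n} → BooleanFunction n → Set
Nilpotent f = ∃ λ k → Constant (f ^ k)

HasClass : ∀ {n} → BooleanFunction n → ℕ → Set
HasClass f k = Constant (f ^ k) × (∀ m → Constant (f ^ m) → k ≤ m)

{-# OPTIONS --safe #-}

-- Every vertex but 0 copies or negates its unique predecessor, so up to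
-- negating coordinates f is a pair of shift registers of lengths ℓ and r with
-- a common first cell z, and z(t) = h (z(t − ℓ), z(t − r)) once t ≥ max(ℓ, r).
-- Let f be nilpotent and normalise its fixed point to 0. Then h(0,0) = 0, and
-- h(1,1) = 0 as 1 is not a fixed point. If a = max(ℓ, r) > b = min(ℓ, r), then
-- h must be ¬ z(t − a) ∧ z(t − b), because otherwise 0 is its
-- own only preimage among the states whose two registers agree. Such an h lets a pattern
-- of period b survive forever unless b ∣ a, and if b ∣ a it gives z(t) = 0 for
-- t ≥ a, as does any h vanishing on the diagonal when a = b. Since z(a − 1) = 1
-- is possible, the last 1 leaves the longer register at time exactly 2a − 1.
module Submission where

open import Defs
open import Data.Bool.Base using (Bool; true; false; not; _∧_; _xor_)
open import Data.Bool.Properties using (¬-not; not-¬; not-injective; not-involutive; xor-assoc; xor-comm; xor-same; xor-identityʳ) renaming (_≟_ to _≟ᵇ_)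
open import Data.Fin.Base using (Fin; zero; suc; toℕ; splitAt; _↑ˡ_)
open import Data.Fin.Properties using (toℕ-injective; toℕ<n; splitAt-↑ˡ; splitAt-↑ʳ; splitAt⁻¹-↑ˡ; splitAt⁻¹-↑ʳ; ↑ˡ-injective; ↑ʳ-injective) renaming (_≟_ to _≟ᶠ_)
open import Data.Nat.Base using (ℕ; zero; suc; _+_; _*_; _∸_; _≤_; _<_; _⊓_; _⊔_; z≤n; s≤s; NonZero)
open import Data.Nat.Divisibility using (_∣_; _∣?_; divides; ∣-refl; ∣m+n∣m⇒∣n; ∣m∣n⇒∣m+n; _∣0)
open import Data.Nat.DivMod using (_%_; m≤n⇒m%n≡m; n%n≡0)
open import Data.Nat.Properties using (≤-refl; ≤-trans; ≤-reflexive; ≤-pred; ≤-total; <⇒≤; <-trans; ≮⇒≥; m≤n⇒m<n∨m≡n; +-comm; +-assoc; +-identityʳ; +-suc; m+[n∸m]≡n; m∸n+n≡m; m<n⇒0<n∸m; m∸n≤m; suc-injective; m≥n⇒m⊓n≡n; m≥n⇒m⊔n≡m; m≤n⇒m⊓n≡m; m≤n⇒m⊔n≡n; n≢0⇒n>0; n≤0⇒n≡0)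
open import Data.Product.Base using (_×_; ∃; ∃₂; _,_; proj₁; proj₂)
open import Data.Sum.Base as Sum using (_⊎_; inj₁; inj₂; [_,_]′)
open import Data.Vec.Base using (Vec; []; _∷_; lookup; tabulate; replicate; _[_]≔_)
open import Data.Vec.Properties using (lookup∘tabulate; tabulate∘lookup; tabulate-cong; lookup∘update; lookup∘update′; lookup-replicate)
open import Function.Base using (_∘_)
open import Function.Bundles using (Equivalence; mk⇔; _⇔_)
open import Relation.Binary.PropositionalEquality using (_≡_; _≢_; refl; sym; trans; cong; cong₂; subst; module ≡-Reasoning)
open import Relation.Nullary.Decidable using (does; yes; no; dec-true; dec-false; does-⇔)
open import Relation.Nullary.Negation using (¬_; contradiction)

-- Iterates and invariants along orbits.

^-+ : ∀ {n} (f : BooleanFunction n) s t x → (f ^ (s + t)) x ≡ (f ^ s) ((f ^ t) x)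
^-+ f zero    t x = refl
^-+ f (suc s) t x = cong f (^-+ f s t x)

^-sucʳ : ∀ {n} (f : BooleanFunction n) k x → (f ^ suc k) x ≡ (f ^ k) (f x)
^-sucʳ f zero    x = refl
^-sucʳ f (suc k) x = cong f (^-sucʳ f k x)

^-invariant : ∀ {n} {f : BooleanFunction n} (P : Vec Bool n → Set) →
              (∀ x → P x → P (f x)) → ∀ k x → P x → P ((f ^ k) x)
^-invariant P step zero    x px = px
^-invariant P step (suc k) x px = step _ (^-invariant P step k x px)

^-fixed : ∀ {n} {f : BooleanFunction n} {c} → f c ≡ c → ∀ k → (f ^ k) c ≡ c
^-fixed {f = f} {c} fc≡c k =
  ^-invariant {f = f} (_≡ c) (λ x x≡c → trans (cong f x≡c) fc≡c) k c refl

-- `f` commutes with its iterates, so `f c`, `f ((f ^ k) c)`, `(f ^ k) (f c)` and `c` all coincide.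
constant-value-fixed : ∀ {n} {f : BooleanFunction n} {c} k →
                       (∀ x → (f ^ k) x ≡ c) → f c ≡ c
constant-value-fixed {f = f} {c} k fᵏ≡c =
  trans (sym (cong f (fᵏ≡c c))) (trans (^-sucʳ f k c) (fᵏ≡c (f c)))

-- Coupled shift registers and their symmetries.

false≢true : false ≢ true
false≢true ()

-- Two shift registers of lengths suc l and suc m with a common cell 0: the
-- observable A x i is cell i of the first one in state x, B x j is cell j of
-- the second one. Only the indices i ≤ l and j ≤ m are meaningful.
record Registers {n} (f : BooleanFunction n) (l m : ℕ)
                 (h : Bool → Bool → Bool) : Set where
  field
    A B      : Vec Bool n → ℕ → Bool
    common   : ∀ x → A x 0 ≡ B x 0
    A-shift  : ∀ x {i} → i < l → A (f x) (suc i) ≡ A x i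
    B-shift  : ∀ x {j} → j < m → B (f x) (suc j) ≡ B x j
    feedback : ∀ x → A (f x) 0 ≡ h (A x l) (B x m)
    state    : ∀ (p q : ℕ → Bool) → p 0 ≡ q 0 → ∃ λ x →
               (∀ {i} → i ≤ l → A x i ≡ p i) × (∀ {j} → j ≤ m → B x j ≡ q j)
    ext      : ∀ {x y} → (∀ {i} → i ≤ l → A x i ≡ A y i) →
               (∀ {j} → j ≤ m → B x j ≡ B y j) → x ≡ y

-- This is the form in which the essential dependence of vertex 0 on its predecessors enters the
-- study of nilpotent functions: it rules out a feedback that is identically 0.
NonConstant : (Bool → Bool → Bool) → Set
NonConstant h = ∃₂ λ u v → ∃₂ λ u′ v′ → h u v ≢ h u′ v′

complemented-nonConstant : ∀ {h} → NonConstant h → NonConstant (λ u v → not (h (not u) (not v)))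
complemented-nonConstant {h} (u , v , u′ , v′ , h≢h′) =
  not u , not v , not u′ , not v′ , λ eq → h≢h′ (begin
    h u v                         ≡⟨ cong₂ h (not-involutive u) (not-involutive v) ⟨
    h (not (not u)) (not (not v)) ≡⟨ not-injective eq ⟩
    h (not (not u′)) (not (not v′)) ≡⟨ cong₂ h (not-involutive u′) (not-involutive v′) ⟩
    h u′ v′                       ∎)
  where open ≡-Reasoning

module _ {n} {f : BooleanFunction n} {l m h} (M : Registers f l m h) where
  open Registers M

  -- Allows the longer register to be taken first, whichever cycle it comes from.
  swapped : Registers f m l (λ v u → h u v)
  swapped = record
    { A        = B
    ; B        = A
    ; common   = λ x → sym (common x)
    ; A-shift  = B-shift
    ; B-shift  = A-shift
    ; feedback = λ x → trans (sym (common (f x))) (feedback x)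
    ; state    = λ p q p0≡q0 → let x , Ax , Bx = state q p (sym p0≡q0)
                                in x , Bx , Ax
    ; ext      = λ B≡ A≡ → ext A≡ B≡
    }

  -- `f` stays the same and only the reading of the cells is negated, which turns a limit with a 1
  -- in the common cell into one with a 0 there.
  complemented : Registers f l m (λ u v → not (h (not u) (not v)))
  complemented = record
    { A        = λ x i → not (A x i)
    ; B        = λ x j → not (B x j)
    ; common   = λ x → cong not (common x)
    ; A-shift  = λ x i<l → cong not (A-shift x i<l)
    ; B-shift  = λ x j<m → cong not (B-shift x j<m)
    ; feedback = λ x → cong not (trans (feedback x)
                   (cong₂ h (sym (not-involutive _)) (sym (not-involutive _))))
    ; state    = λ p q p0≡q0 →
                   let x , Ax , Bx = state (not ∘ p) (not ∘ q) (cong not p0≡q0) in x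
                     , (λ i≤l → trans (cong not (Ax i≤l)) (not-involutive _))
                     , (λ j≤m → trans (cong not (Bx j≤m)) (not-involutive _))
    ; ext      = λ A≡ B≡ → ext (not-injective ∘ A≡) (not-injective ∘ B≡)
    }

  -- Cell `i` delays cell 0 by `i` steps, so late states are determined by the history of the common
  -- cell. `A-early` treats the contents that still date from the initial state.
  A-late : ∀ x i t → i ≤ l → A ((f ^ (i + t)) x) i ≡ A ((f ^ t) x) 0
  A-late x zero    t i≤l = refl
  A-late x (suc i) t i<l = trans (A-shift _ i<l) (A-late x i t (<⇒≤ i<l))

  A-early : ∀ x t i → t + i ≤ l → A ((f ^ t) x) (t + i) ≡ A x i
  A-early x zero    i i≤l   = refl
  A-early x (suc t) i t+i<l = trans (A-shift _ t+i<l) (A-early x t i (<⇒≤ t+i<l))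

-- Extinction of ones and the upper bound on the class.

module _ {n} {f : BooleanFunction n} {l m h} (M : Registers f l m h) where
  open Registers M

  B-late : ∀ x j t → j ≤ m → B ((f ^ (j + t)) x) j ≡ A ((f ^ t) x) 0
  B-late x j t j≤m = trans (A-late (swapped M) x j t j≤m) (sym (common _))

  B-early : ∀ x t j → t + j ≤ m → B ((f ^ t) x) (t + j) ≡ B x j
  B-early = A-early (swapped M)

  -- The second input stays a cell content: no order of `l` and `m` is assumed yet, so that cell may
  -- still hold an initial value.
  feedback-late : ∀ x t → A ((f ^ suc (l + t)) x) 0 ≡
                  h (A ((f ^ t) x) 0) (B ((f ^ (l + t)) x) m)
  feedback-late x t = trans (feedback _) (cong (λ u → h u _) (A-late M x l t ≤-refl))

  DiesOut : Set
  DiesOut = ∀ x t → A ((f ^ suc (l + t)) x) 0 ≡ false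

  -- A 1 at time t forces a 1 at time t ∸ suc m, hence, suc m being a divisor
  -- of suc l, also at time t ∸ suc l, which in turn forces a 0 at time t.
  divides⇒diesOut : (∀ v → h true v ≡ false) → (∀ u → h u false ≡ false) →
                    suc m ∣ suc l → DiesOut
  divides⇒diesOut h1 h0 (divides q l≡qm) x t = ¬-not λ late → false≢true (begin
      false                                                    ≡⟨ h1 _ ⟨
      h true (B ((f ^ (l + t)) x) m)
        ≡⟨ cong (λ u → h u _) (back* q t (trans (sym (at≡ t)) late)) ⟨
      h (A ((f ^ t) x) 0) (B ((f ^ (l + t)) x) m)              ≡⟨ feedback-late x t ⟨
      A ((f ^ suc (l + t)) x) 0                                ≡⟨ late ⟩
      true                                                     ∎)
    where
    open ≡-Reasoning
    at≡ : ∀ t → A ((f ^ (suc l + t)) x) 0 ≡ A ((f ^ (q * suc m + t)) x) 0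
    at≡ t = cong (λ s → A ((f ^ (s + t)) x) 0) l≡qm
    back : ∀ t → A ((f ^ (suc m + t)) x) 0 ≡ true → A ((f ^ t) x) 0 ≡ true
    back t late = ¬-not λ early → false≢true (begin
      false                                                    ≡⟨ h0 _ ⟨
      h (A ((f ^ (m + t)) x) l) false                          ≡⟨ cong (h _) early ⟨
      h (A ((f ^ (m + t)) x) l) (A ((f ^ t) x) 0)              ≡⟨ cong (h _) (B-late x m t ≤-refl) ⟨
      h (A ((f ^ (m + t)) x) l) (B ((f ^ (m + t)) x) m)        ≡⟨ feedback _ ⟨
      A ((f ^ (suc m + t)) x) 0                                ≡⟨ late ⟩
      true                                                     ∎)
    back* : ∀ q t → A ((f ^ (q * suc m + t)) x) 0 ≡ true → A ((f ^ t) x) 0 ≡ true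
    back* zero    t late = late
    back* (suc q) t late = back* q t (back (q * suc m + t)
      (subst (λ s → A ((f ^ s) x) 0 ≡ true) (+-assoc (suc m) (q * suc m) t) late))

  -- At time `2 * suc l ∸ 1` cell `i` holds what cell 0 held `i` steps before, at time
  -- `suc (l + (l ∸ i))`, where `DiesOut` applies. By `m ≤ l` the same holds in the second register.
  diesOut⇒constant : m ≤ l → DiesOut → Constant (f ^ (2 * suc l ∸ 1))
  diesOut⇒constant m≤l dies with state (λ _ → false) (λ _ → false) refl
  ... | o , Ao , Bo = o , λ x → ext
    (λ {i} i≤l → trans (trans (cong (λ s → A ((f ^ s) x) i) (time i≤l))
                         (trans (A-late M x i _ i≤l) (dies x _)))
                       (sym (Ao i≤l)))
    (λ {j} j≤m → trans (trans (cong (λ s → B ((f ^ s) x) j) (time (≤-trans j≤m m≤l)))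
                         (trans (B-late x j _ j≤m) (dies x _)))
                       (sym (Bo j≤m)))
    where
    open ≡-Reasoning
    time : ∀ {i} → i ≤ l → 2 * suc l ∸ 1 ≡ i + suc (l + (l ∸ i))
    time {i} i≤l = begin
      l + (suc l + 0)            ≡⟨ cong (l +_) (+-identityʳ (suc l)) ⟩
      l + suc l                  ≡⟨ +-comm l (suc l) ⟩
      suc l + l                  ≡⟨ cong (suc l +_) (m+[n∸m]≡n i≤l) ⟨
      suc l + (i + (l ∸ i))      ≡⟨ +-assoc (suc l) i (l ∸ i) ⟨
      suc l + i + (l ∸ i)        ≡⟨ cong (_+ (l ∸ i)) (+-comm (suc l) i) ⟩
      i + suc l + (l ∸ i)        ≡⟨ +-assoc i (suc l) (l ∸ i) ⟩
      i + suc (l + (l ∸ i))      ∎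

  -- Constraints on the feedback of a nilpotent function.

  module _ {k c} (fᵏ≡c : ∀ x → (f ^ k) x ≡ c) (c₀≡0 : A c 0 ≡ false) where

    fc≡c : f c ≡ c
    fc≡c = constant-value-fixed {f = f} k fᵏ≡c

    -- The orbit of a state satisfying an invariant ends in `c`. The proofs of `h11`, `h10` and
    -- `<⇒divides` each exhibit an inhabited invariant that fails at `c`.
    reaches-c : (P : Vec Bool n → Set) → (∀ x → P x → P (f x)) → ∃ P → P c
    reaches-c P step (x , px) = subst P (fᵏ≡c x) (^-invariant {f = f} P step k x px)

    -- As `c` is fixed, the shift makes each cell equal to the one before it, and the 0 spreads from
    -- cell 0.
    A-c : ∀ {i} → i ≤ l → A c i ≡ false
    A-c {zero}  _   = c₀≡0
    A-c {suc i} i<l = trans (cong (λ y → A y (suc i)) (sym fc≡c))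
                        (trans (A-shift c i<l) (A-c (<⇒≤ i<l)))

    B-c : ∀ {j} → j ≤ m → B c j ≡ false
    B-c {zero}  _   = trans (sym (common c)) c₀≡0
    B-c {suc j} j<m = trans (cong (λ y → B y (suc j)) (sym fc≡c))
                        (trans (B-shift c j<m) (B-c (<⇒≤ j<m)))

    h00 : h false false ≡ false
    h00 = begin
      h false false      ≡⟨ cong₂ h (A-c ≤-refl) (B-c ≤-refl) ⟨
      h (A c l) (B c m)  ≡⟨ feedback c ⟨
      A (f c) 0          ≡⟨ cong (λ y → A y 0) fc≡c ⟩
      A c 0              ≡⟨ c₀≡0 ⟩
      false              ∎
      where open ≡-Reasoning

    -- Otherwise the all-ones state would be a second fixed point.
    h11 : h true true ≡ false
    h11 = ¬-not λ h≡1 → false≢true (trans (sym c₀≡0)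
      (proj₁ (reaches-c Ones (ones-step h≡1) (state _ _ refl)) z≤n))
      where
      Ones : Vec Bool n → Set
      Ones x = (∀ {i} → i ≤ l → A x i ≡ true) × (∀ {j} → j ≤ m → B x j ≡ true)
      ones-step : h true true ≡ true → ∀ x → Ones x → Ones (f x)
      ones-step h≡1 x (Ax , Bx) = A′ , B′
        where
        A′ : ∀ {i} → i ≤ l → A (f x) i ≡ true
        A′ {zero}  _   = trans (feedback x) (trans (cong₂ h (Ax ≤-refl) (Bx ≤-refl)) h≡1)
        A′ {suc i} i<l = trans (A-shift x i<l) (Ax (<⇒≤ i<l))
        B′ : ∀ {j} → j ≤ m → B (f x) j ≡ true
        B′ {zero}  _   = trans (sym (common (f x))) (A′ z≤n)
        B′ {suc j} j<m = trans (B-shift x j<m) (Bx (<⇒≤ j<m))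

    hdiag : ∀ u → h u u ≡ false
    hdiag false = h00
    hdiag true  = h11

    active : NonConstant h → ∃₂ λ u v → h u v ≡ true
    active (u , v , u′ , v′ , h≢h′) with h u v in eq | h u′ v′ in eq′
    ... | true  | _     = u , v , eq
    ... | false | true  = u′ , v′ , eq′
    ... | false | false = contradiction refl h≢h′

    -- Otherwise c is its own only preimage among the states whose two registers
    -- agree, so that no other such state ever reaches c.
    h10 : m < l → h true false ≡ false
    h10 m<l = ¬-not λ h≡1 →
      proj₂ (reaches-c Nonzero (nonzero-step h≡1) start) A-c
      where
      Nonzero : Vec Bool n → Set
      Nonzero x = (∀ {i} → i ≤ m → A x i ≡ B x i) × ¬ (∀ {i} → i ≤ l → A x i ≡ false)
      start : ∃ Nonzero
      start with state (λ _ → true) (λ _ → true) refl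
      ... | x , Ax , Bx = x
        , (λ i≤m → trans (Ax (≤-trans i≤m (<⇒≤ m<l))) (sym (Bx i≤m)))
        , λ zeros → false≢true (trans (sym (zeros z≤n)) (Ax z≤n))
      nonzero-step : h true false ≡ true → ∀ x → Nonzero x → Nonzero (f x)
      nonzero-step h≡1 x (agree , nonzero) = agree′ , λ zeros → nonzero (undo zeros)
        where
        agree′ : ∀ {i} → i ≤ m → A (f x) i ≡ B (f x) i
        agree′ {zero}  _   = common (f x)
        agree′ {suc i} i<m = trans (A-shift x (<-trans i<m m<l))
                               (trans (agree (<⇒≤ i<m)) (sym (B-shift x i<m)))
        undo : (∀ {i} → i ≤ l → A (f x) i ≡ false) → ∀ {i} → i ≤ l → A x i ≡ false
        undo zeros {i} i≤l with m≤n⇒m<n∨m≡n i≤l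
        ... | inj₁ i<l  = trans (sym (A-shift x i<l)) (zeros i<l)
        -- The shift loses cell `l`, but the feedback betrays it. Agreement gives `B x m` the value
        -- of `A x m`, which is 0 because it moves on to cell `suc m` of the first register. A 1 in
        -- cell `l` would thus put `h true false` into cell 0.
        ... | inj₂ refl = ¬-not λ Axl → false≢true (begin
          false              ≡⟨ zeros z≤n ⟨
          A (f x) 0          ≡⟨ feedback x ⟩
          h (A x l) (B x m)  ≡⟨ cong₂ h Axl (trans (sym (agree ≤-refl))
                                  (trans (sym (A-shift x m<l)) (zeros m<l))) ⟩
          h true false       ≡⟨ h≡1 ⟩
          true               ∎)
          where open ≡-Reasoning

    -- The three other values of `h` are 0.
    h01 : m < l → NonConstant h → h false true ≡ true
    h01 m<l nonconst with active nonconst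
    ... | false , false , h≡1 = contradiction (trans (sym h00) h≡1) false≢true
    ... | false , true  , h≡1 = h≡1
    ... | true  , false , h≡1 = contradiction (trans (sym (h10 m<l)) h≡1) false≢true
    ... | true  , true  , h≡1 = contradiction (trans (sym h11) h≡1) false≢true

    -- Otherwise a 1 in every (suc m)-th cell would circulate forever.
    <⇒divides : m < l → NonConstant h → suc m ∣ suc l
    <⇒divides m<l nonconst with suc m ∣? suc l
    ... | yes m∣l = m∣l
    ... | no  m∤l = contradiction (reaches-c Circulating circulating-step start) c-quiet
      where
      open ≡-Reasoning
      mark : ℕ → Bool
      mark i = does (suc m ∣? i)
      At : ℕ → Vec Bool n → Set
      At s x = (∀ {i} → i ≤ l → A x i ≡ mark (i + s)) × (∀ {j} → j ≤ m → B x j ≡ mark (j + s))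
      Circulating : Vec Bool n → Set
      Circulating x = ∃ λ s → At s x
      start : ∃ Circulating
      start with state (λ i → mark (i + 0)) (λ j → mark (j + 0)) refl
      ... | x , Ax , Bx = x , 0 , Ax , Bx
      -- A shift lowers the phase of the pattern by 1. Modulo `suc m` this is the same as adding
      -- `m`, which avoids subtraction.
      mark-shift : ∀ i s → mark (suc i + (m + s)) ≡ mark (i + s)
      mark-shift i s = does-⇔ (mk⇔
        (λ d → ∣m+n∣m⇒∣n (subst (suc m ∣_) rearr d) ∣-refl)
        (λ d → subst (suc m ∣_) (sym rearr) (∣m∣n⇒∣m+n ∣-refl d)))
        (suc m ∣? _) (suc m ∣? _)
        where
        rearr : suc i + (m + s) ≡ suc m + (i + s)
        rearr = cong suc (trans (sym (+-assoc i m s))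
                  (trans (cong (_+ s) (+-comm i m)) (+-assoc m i s)))
      h-at : ∀ {a b u v} → a ≡ u → b ≡ v → h u v ≡ v → h a b ≡ b
      h-at refl refl eq = eq
      -- `h` returns its second input on every pair but (1, 1). Two simultaneous marks would be
      -- `l ∸ m` apart, so that `suc m` would divide `l ∸ m` and hence `suc l`.
      h-mark : ∀ s → h (mark (l + s)) (mark (m + s)) ≡ mark (m + s)
      h-mark s with suc m ∣? (l + s) | suc m ∣? (m + s)
      ... | no  p | no  q = h-at (dec-false (_ ∣? _) p) (dec-false (_ ∣? _) q) h00
      ... | no  p | yes q = h-at (dec-false (_ ∣? _) p) (dec-true (_ ∣? _) q) (h01 m<l nonconst)
      ... | yes p | no  q = h-at (dec-true (_ ∣? _) p) (dec-false (_ ∣? _) q) (h10 m<l)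
      ... | yes a | yes b = contradiction m∣l m∤l
        where
        m∣l∸m : suc m ∣ l ∸ m
        m∣l∸m = ∣m+n∣m⇒∣n (subst (suc m ∣_) eq a) b
          where
          eq : l + s ≡ m + s + (l ∸ m)
          eq = begin
            l + s            ≡⟨ cong (_+ s) (m∸n+n≡m (<⇒≤ m<l)) ⟨
            l ∸ m + m + s    ≡⟨ +-assoc (l ∸ m) m s ⟩
            l ∸ m + (m + s)  ≡⟨ +-comm (l ∸ m) (m + s) ⟩
            m + s + (l ∸ m)  ∎
        m∣l : suc m ∣ suc l
        m∣l = subst (λ t → suc m ∣ suc t) (m+[n∸m]≡n (<⇒≤ m<l)) (∣m∣n⇒∣m+n ∣-refl m∣l∸m)
      circulating-step : ∀ x → Circulating x → Circulating (f x)
      circulating-step x (s , Ax , Bx) = m + s , A′ , B′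
        where
        A′ : ∀ {i} → i ≤ l → A (f x) i ≡ mark (i + (m + s))
        A′ {zero}  _   = trans (feedback x) (trans (cong₂ h (Ax ≤-refl) (Bx ≤-refl)) (h-mark s))
        A′ {suc i} i<l = trans (A-shift x i<l) (trans (Ax (<⇒≤ i<l)) (sym (mark-shift i s)))
        B′ : ∀ {j} → j ≤ m → B (f x) j ≡ mark (j + (m + s))
        B′ {zero}  _   = trans (sym (common (f x))) (A′ z≤n)
        B′ {suc j} j<m = trans (B-shift x j<m) (trans (Bx (<⇒≤ j<m)) (sym (mark-shift j s)))
      -- Any `suc m` consecutive numbers include a multiple of `suc m`, so the second register
      -- always holds a 1, unlike in `c`.
      marked : ∀ s → ∃ λ j → j ≤ m × suc m ∣ j + s
      marked zero = 0 , z≤n , suc m ∣0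
      marked (suc s) with marked s
      ... | zero  , _   , d = m , ≤-refl , subst (suc m ∣_) (sym (+-suc m s)) (∣m∣n⇒∣m+n ∣-refl d)
      ... | suc j , j<m , d = j , <⇒≤ j<m , subst (suc m ∣_) (sym (+-suc j s)) d
      c-quiet : ¬ Circulating c
      c-quiet (s , _ , Bc) with marked s
      ... | j , j≤m , d = false≢true (trans (sym (B-c j≤m))
                            (trans (Bc j≤m) (dec-true (suc m ∣? _) d)))

    ≤⇒divides : m ≤ l → NonConstant h → suc m ∣ suc l
    ≤⇒divides m≤l nonconst with m≤n⇒m<n∨m≡n m≤l
    ... | inj₁ m<l  = <⇒divides m<l nonconst
    ... | inj₂ refl = ∣-refl

    -- At equal lengths both inputs of the feedback are the same earlier value of the common cell,
    -- so `hdiag` decides. Otherwise the values found for `h` are those that `divides⇒diesOut` asks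
    -- for.
    ≤⇒diesOut : m ≤ l → NonConstant h → DiesOut
    ≤⇒diesOut m≤l nonconst with m≤n⇒m<n∨m≡n m≤l
    ... | inj₁ m<l  = divides⇒diesOut
      (λ { false → h10 m<l ; true → h11 }) (λ { false → h00 ; true → h10 m<l })
      (<⇒divides m<l nonconst)
    ... | inj₂ refl = λ x t → trans (feedback-late x t)
      (trans (cong (h _) (B-late x m t ≤-refl)) (hdiag _))

    -- The lower bound on the class.

    -- Time `l` is the last at which the common cell can be 1, since `DiesOut` sets in at time
    -- `suc l`. This is what makes the bound sharp.
    alive : m ≤ l → 0 < l → NonConstant h → ∃ λ y → A ((f ^ l) y) 0 ≡ true
    alive m≤l 0<l nonconst with m≤n⇒m<n∨m≡n m≤l
    -- The second register starts full of ones, the first with its only 1 in the common cell. Before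
    -- time `l` that 1 has not reached cell `l`, so the feedback is `h false true` and the second
    -- register stays full.
    alive m≤l 0<l nonconst | inj₁ m<l
      with state (λ { zero → true ; (suc _) → false }) (λ _ → true) refl
    ... | y , Ay , By = y , trans (common _) (B-ones l ≤-refl z≤n)
      where
      A-zero : ∀ t → t < l → A ((f ^ t) y) l ≡ false
      A-zero t t<l with m<n⇒0<n∸m t<l | m+[n∸m]≡n (<⇒≤ t<l)
      ... | 0<d | t+d≡l with l ∸ t | m∸n≤m l t
      ... | suc d | d<l = subst (λ i → A ((f ^ t) y) i ≡ false) t+d≡l
        (trans (A-early M y t (suc d) (≤-reflexive t+d≡l)) (Ay d<l))
      B-ones : ∀ t → t ≤ l → ∀ {j} → j ≤ m → B ((f ^ t) y) j ≡ true
      B-ones zero    _   j≤m = By j≤m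
      B-ones (suc t) t<l {zero}  _   = trans (sym (common _)) (trans (feedback _)
        (trans (cong₂ h (A-zero t t<l) (B-ones t (<⇒≤ t<l) ≤-refl)) (h01 m<l nonconst)))
      B-ones (suc t) t<l {suc j} j<m = trans (B-shift _ j<m) (B-ones t (<⇒≤ t<l) (<⇒≤ j<m))
    -- The initial cells 1 of both registers reach their ends at time `l′`, and one step later
    -- `h u v` enters cell 0.
    alive m≤l (s≤s {n = l′} _) nonconst | inj₂ refl with active nonconst
    ... | u , v , h≡1
      with state (λ { zero → false ; (suc _) → u }) (λ { zero → false ; (suc _) → v }) refl
    ... | y , Ay , By = y , trans (feedback _) (trans (cong₂ h
      (subst (λ i → A ((f ^ l′) y) i ≡ u) l′+1≡l
        (trans (A-early M y l′ 1 (≤-reflexive l′+1≡l)) (Ay (s≤s z≤n))))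
      (subst (λ j → B ((f ^ l′) y) j ≡ v) l′+1≡l
        (trans (B-early y l′ 1 (≤-reflexive l′+1≡l)) (By (s≤s z≤n))))) h≡1)
      where
      l′+1≡l : l′ + 1 ≡ suc l′
      l′+1≡l = +-comm l′ 1

    -- A 1 in the common cell at time l is still in cell l at time l + l.
    class-≥ : m ≤ l → 0 < l → NonConstant h → ∀ j → Constant (f ^ j) → 2 * suc l ∸ 1 ≤ j
    class-≥ m≤l 0<l nonconst j (d , fʲ≡d) = ≮⇒≥ too-early
      where
      open ≡-Reasoning
      too-early : ¬ j < 2 * suc l ∸ 1
      too-early j<N with alive m≤l 0<l nonconst
      ... | y , y-alive = false≢true (begin
          false                    ≡⟨ A-c ≤-refl ⟨
          A c l                    ≡⟨ cong (λ z → A z l) (^-fixed {f = f} fc≡c (l + l)) ⟨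
          A ((f ^ (l + l)) c) l    ≡⟨ cong (λ z → A z l) (trans (merged c) (sym (merged y))) ⟩
          A ((f ^ (l + l)) y) l    ≡⟨ A-late M y l l ≤-refl ⟩
          A ((f ^ l) y) 0          ≡⟨ y-alive ⟩
          true                     ∎)
        where
        j≤l+l : j ≤ l + l
        j≤l+l = ≤-pred (subst (suc j ≤_)
          (trans (cong (l +_) (+-identityʳ (suc l))) (+-suc l l)) j<N)
        merged : ∀ x → (f ^ (l + l)) x ≡ (f ^ (l + l ∸ j)) d
        merged x = begin
          (f ^ (l + l)) x                ≡⟨ cong (λ s → (f ^ s) x) (m∸n+n≡m j≤l+l) ⟨
          (f ^ (l + l ∸ j + j)) x        ≡⟨ ^-+ f (l + l ∸ j) j x ⟩
          (f ^ (l + l ∸ j)) ((f ^ j) x)  ≡⟨ cong (f ^ (l + l ∸ j)) (fʲ≡d x) ⟩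
          (f ^ (l + l ∸ j)) d            ∎

    divides×class : m ≤ l → 0 < l → NonConstant h → suc m ∣ suc l × HasClass f (2 * suc l ∸ 1)
    divides×class m≤l 0<l nonconst = ≤⇒divides m≤l nonconst
      , diesOut⇒constant m≤l (≤⇒diesOut m≤l nonconst)
      , class-≥ m≤l 0<l nonconst

-- If the common cell of the limit is 1, the complemented reading makes it 0.
nilpotent⇒divides×class : ∀ {n} {f : BooleanFunction n} {l m h} → Registers f l m h →
  NonConstant h → Nilpotent f → m ≤ l → 0 < l →
  suc m ∣ suc l × HasClass f (2 * suc l ∸ 1)
nilpotent⇒divides×class M nonconst (k , c , fᵏ≡c) m≤l 0<l with Registers.A M c 0 in c₀
... | false = divides×class M {k = k} fᵏ≡c c₀ m≤l 0<l nonconst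
... | true  = divides×class (complemented M) {k = k} fᵏ≡c (cong not c₀) m≤l 0<l
                (complemented-nonConstant nonconst)

-- Essential dependence on coordinates.

lookup-ext : ∀ {n} {x y : Vec Bool n} → (∀ v → lookup x v ≡ lookup y v) → x ≡ y
lookup-ext {x = x} {y} eq =
  trans (sym (tabulate∘lookup x)) (trans (tabulate-cong eq) (tabulate∘lookup y))

-- Turn a into b one coordinate at a time: some single change alters F.
sensitive-coordinate : ∀ {n} (F : Vec Bool n → Bool) a b → F a ≢ F b →
  ∃ λ j → lookup a j ≢ lookup b j ×
  ∃₂ λ a′ b′ → DifferOnlyAt j a′ b′ × F a′ ≢ F b′
sensitive-coordinate F []      []      Fa≢Fb = contradiction refl Fa≢Fb
sensitive-coordinate F (x ∷ a) (y ∷ b) Fa≢Fb with F (x ∷ a) ≟ᵇ F (y ∷ a)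
... | no  F≢ = zero , x≢y , x ∷ a , y ∷ a , (x≢y , others) , F≢
  where
  x≢y : x ≢ y
  x≢y x≡y = F≢ (cong (λ z → F (z ∷ a)) x≡y)
  others : ∀ k → k ≢ zero → lookup (x ∷ a) k ≡ lookup (y ∷ a) k
  others zero    k≢0 = contradiction refl k≢0
  others (suc k) _   = refl
... | yes F≡ with sensitive-coordinate (F ∘ (y ∷_)) a b (Fa≢Fb ∘ trans F≡)
...   | j , aj≢bj , a′ , b′ , (a′j≢b′j , others) , F≢ =
  suc j , aj≢bj , y ∷ a′ , y ∷ b′ , (a′j≢b′j , others′) , F≢
  where
  others′ : ∀ k → k ≢ suc j → lookup (y ∷ a′) k ≡ lookup (y ∷ b′) k
  others′ zero    _   = refl
  others′ (suc k) k≢j = others k (k≢j ∘ cong suc)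

spike : ∀ {n} → Bool → Fin n → Vec Bool n
spike t u = replicate _ t [ u ]≔ not t

lookup-spike : ∀ {n} t (u : Fin n) → lookup (spike t u) u ≡ not t
lookup-spike t u = lookup∘update u (replicate _ t) (not t)

lookup-spike′ : ∀ {n} t {u k : Fin n} → k ≢ u → lookup (spike t u) k ≡ t
lookup-spike′ t {k = k} k≢u =
  trans (lookup∘update′ k≢u (replicate _ t) (not t)) (lookup-replicate k t)

spike-differs : ∀ {n} t (u : Fin n) → DifferOnlyAt u (replicate n t) (spike t u)
spike-differs t u =
    (λ eq → not-¬ (lookup-replicate u t) (trans eq (lookup-spike t u)))
  , λ k k≢u → trans (lookup-replicate k t) (sym (lookup-spike′ t k≢u))

xor-cancelˡ : ∀ s t → s xor (s xor t) ≡ t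
xor-cancelˡ s t = trans (sym (xor-assoc s s t)) (cong (_xor t) (xor-same s))

xor-injectiveˡ : ∀ s {t u} → s xor t ≡ s xor u → t ≡ u
xor-injectiveˡ s {t} {u} eq =
  trans (sym (xor-cancelˡ s t)) (trans (cong (s xor_) eq) (xor-cancelˡ s u))

module _ {n} {G : Digraph n} (f : BooleanFunction n) (adm : Admits G f) where

  -- If the two values differed, `sensitive-coordinate` would produce an arc into `v` from a
  -- coordinate where `a` and `b` differ.
  local : ∀ v {a b} → (∀ u → G u v → lookup a u ≡ lookup b u) → lookup (f a) v ≡ lookup (f b) v
  local v {a} {b} agree with lookup (f a) v ≟ᵇ lookup (f b) v
  ... | yes eq = eq
  ... | no neq with sensitive-coordinate (λ x → lookup (f x) v) a b neq
  ...   | u , au≢bu , witness = contradiction (agree u (Equivalence.from (adm u v) witness)) au≢bu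

  -- By locality the vertex is a function of one bit, which constant vectors suffice to evaluate.
  -- The arc makes it nonconstant, and a nonconstant function of one bit is xor with its value at 0.
  copies-or-negates : ∀ {u v} → (∀ {w} → G w v → w ≡ u) → G u v → ∀ x →
    lookup (f x) v ≡ lookup (f (replicate n false)) v xor lookup x u
  copies-or-negates {u} {v} unique arc x = trans (via-φ x) (φ-xor (lookup x u))
    where
    φ : Bool → Bool
    φ t = lookup (f (replicate n t)) v
    via-φ : ∀ x → lookup (f x) v ≡ φ (lookup x u)
    via-φ x = local v λ w wv → trans (cong (lookup x) (unique wv)) (sym (lookup-replicate w _))
    φ-nonconstant : φ true ≢ φ false
    φ-nonconstant φ≡ with Equivalence.to (adm u v) arc
    ... | a , b , _ , fa≢fb = fa≢fb (trans (via-φ a) (trans (to-false (lookup a u))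
                                (trans (sym (to-false (lookup b u))) (sym (via-φ b)))))
      where
      to-false : ∀ t → φ t ≡ φ false
      to-false false = refl
      to-false true  = φ≡
    φ-xor : ∀ t → φ t ≡ φ false xor t
    φ-xor false = sym (xor-identityʳ _)
    φ-xor true  = trans (¬-not φ-nonconstant) (xor-comm true _)

-- Arcs of a single cycle.

-- The indices beyond l are sent to junk values.
cell : (l : ℕ) → ℕ → Fin (suc l)
cell l       zero    = zero
cell zero    (suc i) = zero
cell (suc l) (suc i) = suc (cell l i)

toℕ-cell : ∀ {l i} → i ≤ l → toℕ (cell l i) ≡ i
toℕ-cell z≤n       = refl
toℕ-cell (s≤s i≤l) = cong suc (toℕ-cell i≤l)

cell-toℕ : ∀ {l} (i : Fin (suc l)) → cell l (toℕ i) ≡ i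
cell-toℕ         zero    = refl
cell-toℕ {suc l} (suc i) = cong suc (cell-toℕ i)

cycle-arc : ∀ {l i} → i < l → Cycle (suc l) (cell l i) (cell l (suc i))
cycle-arc {l} {i} i<l = begin
  toℕ (cell l (suc i))          ≡⟨ toℕ-cell i<l ⟩
  suc i                         ≡⟨ m≤n⇒m%n≡m i<l ⟨
  suc i % suc l                 ≡⟨ cong (λ k → suc k % suc l) (toℕ-cell (<⇒≤ i<l)) ⟨
  suc (toℕ (cell l i)) % suc l  ∎
  where open ≡-Reasoning

cycle-closing-arc : ∀ l → Cycle (suc l) (cell l l) zero
cycle-closing-arc l =
  sym (trans (cong (λ k → suc k % suc l) (toℕ-cell {l} ≤-refl)) (n%n≡0 (suc l)))

cycle-successor : ∀ {l} (k : Fin (suc l)) →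
  (toℕ k < l × suc (toℕ k) % suc l ≡ suc (toℕ k)) ⊎ (toℕ k ≡ l × suc (toℕ k) % suc l ≡ 0)
cycle-successor {l} k with m≤n⇒m<n∨m≡n (≤-pred (toℕ<n k))
... | inj₁ k<l = inj₁ (k<l , m≤n⇒m%n≡m k<l)
... | inj₂ k≡l = inj₂ (k≡l , trans (cong (λ t → suc t % suc l) k≡l) (n%n≡0 (suc l)))

cycle-predecessor : ∀ {l i k} → i < l → Cycle (suc l) k (cell l (suc i)) → k ≡ cell l i
cycle-predecessor {l} {i} {k} i<l arc with cycle-successor k | trans (sym (toℕ-cell i<l)) arc
... | inj₁ (_ , eq) | si≡ =
  toℕ-injective (trans (suc-injective (sym (trans si≡ eq))) (sym (toℕ-cell (<⇒≤ i<l))))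
... | inj₂ (_ , eq) | si≡ = contradiction (trans si≡ eq) λ ()

cycle-closing-predecessor : ∀ {l k} → Cycle (suc l) k zero → k ≡ cell l l
cycle-closing-predecessor {l} {k} arc with cycle-successor k
... | inj₁ (_ , eq)   = contradiction (trans arc eq) λ ()
... | inj₂ (k≡l , eq) = toℕ-injective (trans k≡l (sym (toℕ-cell {l} ≤-refl)))

-- Vertices and predecessors in the double-cycle.

module _ (l m : ℕ) where

  private
    G : Digraph (suc l + m)
    G = DoubleCycle (suc l) (suc m)

  -- `P 0` and `Q 0` both reduce to `zero`, the shared vertex.
  P Q : ℕ → Fin (suc l + m)
  P i = left (suc l) (suc m) (cell l i)
  Q j = right (suc l) (suc m) (cell m j)

  -- Vertex 0 counts as a vertex of the left cycle.
  position : Fin (suc l + m) → ℕ ⊎ ℕ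
  position v = Sum.map toℕ (suc ∘ toℕ) (splitAt (suc l) v)

  position-left : ∀ k → position (left (suc l) (suc m) k) ≡ inj₁ (toℕ k)
  position-left k = cong (Sum.map toℕ (suc ∘ toℕ)) (splitAt-↑ˡ (suc l) k m)

  position-right : ∀ k → position (right (suc l) (suc m) (suc k)) ≡ inj₂ (suc (toℕ k))
  position-right k = cong (Sum.map toℕ (suc ∘ toℕ)) (splitAt-↑ʳ (suc l) m k)

  position-P : ∀ {i} → i ≤ l → position (P i) ≡ inj₁ i
  position-P {i} i≤l = trans (position-left (cell l i)) (cong inj₁ (toℕ-cell i≤l))

  position-Q : ∀ {j} → j < m → position (Q (suc j)) ≡ inj₂ (suc j)
  position-Q {j} j<m = trans (suc-case (cell m (suc j)) (toℕ-cell j<m)) (cong inj₂ (toℕ-cell j<m))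
    where
    suc-case : ∀ k → toℕ k ≡ suc j → position (right (suc l) (suc m) k) ≡ inj₂ (toℕ k)
    suc-case (suc k) _ = position-right k

  left≢right : ∀ {k k′} → left (suc l) (suc m) k ≢ right (suc l) (suc m) (suc k′)
  left≢right {k} {k′} eq
    with () ← trans (sym (position-left k)) (trans (cong position eq) (position-right k′))

  left≡right⇒0 : ∀ {k k′} → left (suc l) (suc m) k ≡ right (suc l) (suc m) k′ → k ≡ zero
  left≡right⇒0 {zero}          eq = refl
  left≡right⇒0 {suc k} {suc k′} eq = contradiction eq left≢right

  right-injective : ∀ {k k′} → right (suc l) (suc m) k ≡ right (suc l) (suc m) k′ → k ≡ k′
  right-injective {zero}  {zero}   eq = refl
  right-injective {suc k} {suc k′} eq = cong suc (↑ʳ-injective (suc l) k k′ eq)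

  -- A view of the vertices along the two paths out of vertex 0, with the shared vertex listed once.
  data Vertex : Fin (suc l + m) → Set where
    base : Vertex (P 0)
    on-P : ∀ {i} → i < l → Vertex (P (suc i))
    on-Q : ∀ {j} → j < m → Vertex (Q (suc j))

  vertex : ∀ v → Vertex v
  vertex v with splitAt (suc l) v in eq
  ... | inj₁ zero    = subst Vertex (splitAt⁻¹-↑ˡ eq) base
  ... | inj₁ (suc i) = subst Vertex
    (trans (cong (_↑ˡ m) (cell-toℕ (suc i))) (splitAt⁻¹-↑ˡ eq)) (on-P (toℕ<n i))
  ... | inj₂ j       = subst Vertex
    (trans (cong (right (suc l) (suc m)) (cell-toℕ (suc j))) (splitAt⁻¹-↑ʳ eq)) (on-Q (toℕ<n j))

  arc-P : ∀ {i} → i < l → G (P i) (P (suc i))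
  arc-P i<l = inj₁ (_ , _ , cycle-arc i<l , refl , refl)

  arc-Q : ∀ {j} → j < m → G (Q j) (Q (suc j))
  arc-Q j<m = inj₂ (_ , _ , cycle-arc j<m , refl , refl)

  closing-P : G (P l) (P 0)
  closing-P = inj₁ (_ , _ , cycle-closing-arc l , refl , refl)

  closing-Q : G (Q m) (P 0)
  closing-Q = inj₂ (_ , _ , cycle-closing-arc m , refl , refl)

  predecessor-P : ∀ {i u} → i < l → G u (P (suc i)) → u ≡ P i
  predecessor-P {i} i<l (inj₁ (k , k′ , arc , refl , eq))
    with refl ← ↑ˡ-injective m (cell l (suc i)) k′ eq =
    cong (left (suc l) (suc m)) (cycle-predecessor i<l arc)
  predecessor-P i<l (inj₂ (_ , k′ , _ , _ , eq)) =
    contradiction (trans (sym (toℕ-cell i<l)) (cong toℕ (left≡right⇒0 {k′ = k′} eq))) λ ()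

  predecessor-Q : ∀ {j u} → j < m → G u (Q (suc j)) → u ≡ Q j
  predecessor-Q {j} j<m (inj₁ (k , k′ , _ , _ , eq))
    with cell m (suc j) | toℕ-cell j<m | eq
  ... | suc _ | _ | eq′ = contradiction (sym eq′) left≢right
  predecessor-Q {j} j<m (inj₂ (k , k′ , arc , refl , eq))
    with refl ← right-injective {cell m (suc j)} {k′} eq =
    cong (right (suc l) (suc m)) (cycle-predecessor j<m arc)

  predecessor-0 : ∀ {u} → G u (P 0) → u ≡ P l ⊎ u ≡ Q m
  predecessor-0 (inj₁ (k , k′ , arc , refl , eq))
    with refl ← ↑ˡ-injective m zero k′ eq =
    inj₁ (cong (left (suc l) (suc m)) (cycle-closing-predecessor arc))
  predecessor-0 (inj₂ (k , k′ , arc , refl , eq))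
    with refl ← right-injective {zero} {k′} eq =
    inj₂ (cong (right (suc l) (suc m)) (cycle-closing-predecessor arc))

  -- The cycles meet only in vertex 0, so equal ends would both be that vertex. Hence the two inputs
  -- of the feedback can be set independently.
  ends-differ : ¬ (l ≡ 0 × m ≡ 0) → P l ≢ Q m
  ends-differ nonloop eq = nonloop (l≡0 , m≡0 (cell m m) refl)
    where
    l≡0 : l ≡ 0
    l≡0 = trans (sym (toℕ-cell {l} ≤-refl)) (cong toℕ (left≡right⇒0 {k′ = cell m m} eq))
    m≡0 : ∀ k → k ≡ cell m m → m ≡ 0
    m≡0 zero    k≡ = trans (sym (toℕ-cell {m} ≤-refl)) (sym (cong toℕ k≡))
    m≡0 (suc k) k≡ =
      contradiction (trans eq (cong (right (suc l) (suc m)) (sym k≡))) left≢right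

  -- Functions on the double-cycle as registers.

  module _ {f : BooleanFunction (suc l + m)} (σ τ : ℕ → Bool) where

    cells⇒registers : ∀ {h} → σ 0 ≡ τ 0 →
      (∀ x {i} → i < l → σ (suc i) xor lookup (f x) (P (suc i)) ≡ σ i xor lookup x (P i)) →
      (∀ x {j} → j < m → τ (suc j) xor lookup (f x) (Q (suc j)) ≡ τ j xor lookup x (Q j)) →
      (∀ x → σ 0 xor lookup (f x) (P 0) ≡ h (σ l xor lookup x (P l)) (τ m xor lookup x (Q m))) →
      Registers f l m h
    cells⇒registers σ0≡τ0 shift-P shift-Q feedback = record
      { A        = A
      ; B        = B
      ; common   = common
      ; A-shift  = shift-P
      ; B-shift  = shift-Q
      ; feedback = feedback
      ; state    = λ p q p0≡q0 → x p q , A-x p q , B-x p q p0≡q0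
      ; ext      = ext
      }
      where
      A B : Vec Bool (suc l + m) → ℕ → Bool
      A x i = σ i xor lookup x (P i)
      B x j = τ j xor lookup x (Q j)
      common : ∀ x → A x 0 ≡ B x 0
      common x = cong (_xor lookup x zero) σ0≡τ0
      module _ (p q : ℕ → Bool) where
        value : ℕ ⊎ ℕ → Bool
        value = [ (λ i → σ i xor p i) , (λ j → τ j xor q j) ]′
        x : Vec Bool (suc l + m)
        x = tabulate (value ∘ position)
        A-x : ∀ {i} → i ≤ l → A x i ≡ p i
        A-x {i} i≤l = trans (cong (σ i xor_) (trans (lookup∘tabulate (value ∘ position) (P i))
          (cong value (position-P i≤l)))) (xor-cancelˡ (σ i) (p i))
        B-x : p 0 ≡ q 0 → ∀ {j} → j ≤ m → B x j ≡ q j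
        B-x p0≡q0 {zero}  _   = trans (sym (common x)) (trans (A-x z≤n) p0≡q0)
        B-x p0≡q0 {suc j} j<m = trans (cong (τ (suc j) xor_) (trans (lookup∘tabulate (value ∘ position) (Q (suc j)))
          (cong value (position-Q j<m)))) (xor-cancelˡ (τ (suc j)) (q (suc j)))
      ext : ∀ {x y} → (∀ {i} → i ≤ l → A x i ≡ A y i) → (∀ {j} → j ≤ m → B x j ≡ B y j) → x ≡ y
      ext {x} {y} A≡ B≡ = lookup-ext λ v → at (vertex v)
        where
        at : ∀ {v} → Vertex v → lookup x v ≡ lookup y v
        at base           = xor-injectiveˡ (σ 0) (A≡ z≤n)
        at (on-P {i} i<l) = xor-injectiveˡ (σ (suc i)) (A≡ i<l)
        at (on-Q {j} j<m) = xor-injectiveˡ (τ (suc j)) (B≡ j<m)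

  module _ (nonloop : ¬ (l ≡ 0 × m ≡ 0)) where

    module _ {f : BooleanFunction (suc l + m)} (adm : Admits G f) where

      private
        -- Reading each cell up to the number of negations between vertex 0 and
        -- that cell turns both paths into plain shifts.
        parity : (ℕ → Fin (suc l + m)) → ℕ → Bool
        parity R zero    = false
        parity R (suc i) = parity R i xor lookup (f (replicate _ false)) (R (suc i))

        shift : ∀ R {i} → (∀ {w} → G w (R (suc i)) → w ≡ R i) → G (R i) (R (suc i)) → ∀ x →
          parity R (suc i) xor lookup (f x) (R (suc i)) ≡ parity R i xor lookup x (R i)
        shift R {i} unique arc x =
          trans (cong (parity R (suc i) xor_) (copies-or-negates f adm unique arc x))
                (trans (xor-assoc (parity R i) c _) (cong (parity R i xor_) (xor-cancelˡ c _)))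
          where
          c : Bool
          c = lookup (f (replicate _ false)) (R (suc i))

        -- The filler `b` also lands on `Q m`, which is distinct from `P l`.
        ends : Bool → Bool → Vec Bool (suc l + m)
        ends a b = replicate _ b [ P l ]≔ a

        -- The inputs are register readings, so the parities are undone before `f` is applied. The
        -- output needs no correction, the parity of cell 0 being `false`.
        feedback : Bool → Bool → Bool
        feedback u v = lookup (f (ends (parity P l xor u) (parity Q m xor v))) (P 0)

        feedback-correct : ∀ x → lookup (f x) (P 0) ≡
          feedback (parity P l xor lookup x (P l)) (parity Q m xor lookup x (Q m))
        feedback-correct x = local f adm (P 0) {x} {ends a b} λ u arc → agree (predecessor-0 arc)
          where
          a b : Bool
          a = parity P l xor (parity P l xor lookup x (P l))
          b = parity Q m xor (parity Q m xor lookup x (Q m))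
          agree : ∀ {u} → u ≡ P l ⊎ u ≡ Q m → lookup x u ≡ lookup (ends a b) u
          agree (inj₁ refl) = sym (trans (lookup∘update (P l) (replicate _ b) a)
            (xor-cancelˡ (parity P l) _))
          agree (inj₂ refl) = sym (trans
            (lookup∘update′ (ends-differ nonloop ∘ sym) (replicate _ b) a)
            (trans (lookup-replicate (Q m) b) (xor-cancelˡ (parity Q m) _)))

      admitted⇒registers : ∃ λ h → Registers f l m h × NonConstant h
      admitted⇒registers = feedback
        , cells⇒registers (parity P) (parity Q) refl
            (λ x i<l → shift P (predecessor-P i<l) (arc-P i<l) x)
            (λ x j<m → shift Q (predecessor-Q j<m) (arc-Q j<m) x)
            feedback-correct
        , nonconstant
        where
        nonconstant : NonConstant feedback
        nonconstant with Equivalence.to (adm (P l) (P 0)) closing-P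
        ... | a , b , _ , fa≢fb = _ , _ , _ , _ , λ eq →
          fa≢fb (trans (feedback-correct a) (trans eq (sym (feedback-correct b))))

      admitted∧nilpotent : Nilpotent f →
        (suc l ⊓ suc m) ∣ (suc l ⊔ suc m) × HasClass f (2 * (suc l ⊔ suc m) ∸ 1)
      admitted∧nilpotent nil with admitted⇒registers | ≤-total m l
      ... | h , M , nonconst | inj₁ m≤l
        rewrite m≥n⇒m⊓n≡n m≤l | m≥n⇒m⊔n≡m m≤l =
        nilpotent⇒divides×class M nonconst nil m≤l
          (n≢0⇒n>0 λ l≡0 → nonloop (l≡0 , n≤0⇒n≡0 (subst (m ≤_) l≡0 m≤l)))
      ... | h , M , (u , v , u′ , v′ , h≢) | inj₂ l≤m
        rewrite m≤n⇒m⊓n≡m l≤m | m≤n⇒m⊔n≡n l≤m =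
        nilpotent⇒divides×class (swapped M) (v , u , v′ , u′ , h≢) nil l≤m
          (n≢0⇒n>0 λ m≡0 → nonloop (n≤0⇒n≡0 (subst (l ≤_) m≡0 l≤m) , m≡0))

    -- Realising a prescribed feedback.

    module _ (h : Bool → Bool → Bool) where

      private
        next : Vec Bool (suc l + m) → ℕ ⊎ ℕ → Bool
        next x (inj₁ zero)    = h (lookup x (P l)) (lookup x (Q m))
        next x (inj₁ (suc i)) = lookup x (P i)
        -- A default value: `position` gives only positive indices on the right.
        next x (inj₂ zero)    = false
        next x (inj₂ (suc j)) = lookup x (Q j)

      shiftWithFeedback : BooleanFunction (suc l + m)
      shiftWithFeedback x = tabulate (next x ∘ position)

      private
        F : BooleanFunction (suc l + m)
        F = shiftWithFeedback

        F-0 : ∀ x → lookup (F x) (P 0) ≡ h (lookup x (P l)) (lookup x (Q m))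
        F-0 x = refl

        F-P : ∀ x {i} → i < l → lookup (F x) (P (suc i)) ≡ lookup x (P i)
        F-P x {i} i<l = trans (lookup∘tabulate (next x ∘ position) (P (suc i))) (cong (next x) (position-P i<l))

        F-Q : ∀ x {j} → j < m → lookup (F x) (Q (suc j)) ≡ lookup x (Q j)
        F-Q x {j} j<m = trans (lookup∘tabulate (next x ∘ position) (Q (suc j))) (cong (next x) (position-Q j<m))

      shiftWithFeedback-registers : Registers F l m h
      shiftWithFeedback-registers =
        cells⇒registers (λ _ → false) (λ _ → false) refl F-P F-Q F-0

      -- Dependence of `h` is tested from diagonal points, so that a constant vector and its spike
      -- at `P l` or `Q m` witness the arc into vertex 0.
      shiftWithFeedback-admitted :
        (∃ λ w → h w w ≢ h (not w) w) → (∃ λ w → h w w ≢ h w (not w)) → Admits G F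
      shiftWithFeedback-admitted (w , w-left) (w′ , w-right) u v =
        mk⇔ (λ arc → influence (vertex v) arc) (influence⁻¹ (vertex v))
        where
        influence : ∀ {u v} → Vertex v → G u v → InteractionGraph F u v
        influence (on-P {i} i<l) arc with refl ← predecessor-P i<l arc =
          replicate _ false , spike false (P i) , spike-differs false (P i) , λ eq → proj₁ (spike-differs false (P i))
            (trans (sym (F-P _ i<l)) (trans eq (F-P _ i<l)))
        influence (on-Q {j} j<m) arc with refl ← predecessor-Q j<m arc =
          replicate _ false , spike false (Q j) , spike-differs false (Q j) , λ eq → proj₁ (spike-differs false (Q j))
            (trans (sym (F-Q _ j<m)) (trans eq (F-Q _ j<m)))
        influence base arc with predecessor-0 arc
        ... | inj₁ refl = replicate _ w , spike w (P l) , spike-differs w (P l) , λ eq → w-left (begin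
          h w w        ≡⟨ cong₂ h (lookup-replicate (P l) w) (lookup-replicate (Q m) w) ⟨
          _            ≡⟨ eq ⟩
          _            ≡⟨ cong₂ h (lookup-spike w (P l)) (lookup-spike′ w (ends-differ nonloop ∘ sym)) ⟩
          h (not w) w  ∎)
          where open ≡-Reasoning
        ... | inj₂ refl = replicate _ w′ , spike w′ (Q m) , spike-differs w′ (Q m) , λ eq → w-right (begin
          h w′ w′        ≡⟨ cong₂ h (lookup-replicate (P l) w′) (lookup-replicate (Q m) w′) ⟨
          _              ≡⟨ eq ⟩
          _              ≡⟨ cong₂ h (lookup-spike′ w′ (ends-differ nonloop)) (lookup-spike w′ (Q m)) ⟩
          h w′ (not w′)  ∎)
          where open ≡-Reasoning

        influence⁻¹ : ∀ {u v} → Vertex v → InteractionGraph F u v → G u v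
        influence⁻¹ {u} (on-P {i} i<l) (a , b , (_ , same) , Fa≢Fb) with u ≟ᶠ P i
        ... | yes refl = arc-P i<l
        ... | no  u≢   = contradiction
          (trans (F-P a i<l) (trans (same (P i) (u≢ ∘ sym)) (sym (F-P b i<l)))) Fa≢Fb
        influence⁻¹ {u} (on-Q {j} j<m) (a , b , (_ , same) , Fa≢Fb) with u ≟ᶠ Q j
        ... | yes refl = arc-Q j<m
        ... | no  u≢   = contradiction
          (trans (F-Q a j<m) (trans (same (Q j) (u≢ ∘ sym)) (sym (F-Q b j<m)))) Fa≢Fb
        influence⁻¹ {u} base (a , b , (_ , same) , Fa≢Fb) with u ≟ᶠ P l | u ≟ᶠ Q m
        ... | yes refl | _        = closing-P
        ... | no _     | yes refl = closing-Q
        ... | no u≢P   | no u≢Q   = contradiction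
          (cong₂ h (same (P l) (u≢P ∘ sym)) (same (Q m) (u≢Q ∘ sym))) Fa≢Fb

    -- The longer cycle enters the feedback negated.
    divides⇒admits-nilpotent : (suc l ⊓ suc m) ∣ (suc l ⊔ suc m) →
      ∃ λ f → Admits G f × Nilpotent f
    divides⇒admits-nilpotent min∣max with ≤-total m l
    ... | inj₁ m≤l rewrite m≥n⇒m⊓n≡n m≤l | m≥n⇒m⊔n≡m m≤l =
      shiftWithFeedback h
        -- Either flip leads from the diagonal to (0, 1), the only pair at which this `h` is 1.
        , shiftWithFeedback-admitted h (true , λ ()) (false , λ ())
        , 2 * suc l ∸ 1 , diesOut⇒constant M m≤l
                (divides⇒diesOut M (λ _ → refl) (λ { false → refl ; true → refl }) min∣max)
      where
      h : Bool → Bool → Bool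
      h u v = not u ∧ v
      M : Registers (shiftWithFeedback h) l m h
      M = shiftWithFeedback-registers h
    ... | inj₂ l≤m rewrite m≤n⇒m⊓n≡m l≤m | m≤n⇒m⊔n≡n l≤m =
      shiftWithFeedback h
        , shiftWithFeedback-admitted h (false , λ ()) (true , λ ())
        , 2 * suc m ∸ 1 , diesOut⇒constant M l≤m
                (divides⇒diesOut M (λ { false → refl ; true → refl }) (λ _ → refl) min∣max)
      where
      h : Bool → Bool → Bool
      h u v = u ∧ not v
      M : Registers (shiftWithFeedback h) m l (λ v u → h u v)
      M = swapped (shiftWithFeedback-registers h)

-- The single loop and the conclusion.

-- The two loops coincide, so vertex 0 copies or negates itself. Then `f` and all its iterates are
-- injective on two states, hence never constant, although 1 divides 1.
loop-not-nilpotent : ∀ {f} → Admits (DoubleCycle 1 1) f → ¬ Nilpotent f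
loop-not-nilpotent {f} adm (k , c , fᵏ≡c) =
  false≢true (cong (λ x → lookup x zero) (^-injective k
    (trans (fᵏ≡c (false ∷ [])) (sym (fᵏ≡c (true ∷ []))))))
  where
  f₀ : ∀ x → lookup (f x) zero ≡ lookup (f (replicate 1 false)) zero xor lookup x zero
  f₀ = copies-or-negates f adm (λ { {zero} _ → refl }) (inj₁ (zero , zero , refl , refl , refl))
  f-injective : ∀ {x y} → f x ≡ f y → x ≡ y
  f-injective {x} {y} fx≡fy = lookup-ext λ { zero → xor-injectiveˡ (lookup (f (replicate 1 false)) zero)
    (trans (sym (f₀ x)) (trans (cong (λ z → lookup z zero) fx≡fy) (f₀ y))) }
  ^-injective : ∀ k {x y} → (f ^ k) x ≡ (f ^ k) y → x ≡ y
  ^-injective zero    eq = eq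
  ^-injective (suc k) eq = ^-injective k (f-injective eq)

theorem3 : (ℓ r : ℕ) .{{_ : NonZero ℓ}} .{{_ : NonZero r}} →
    (¬ (ℓ ≡ 1 × r ≡ 1) →
    (∃ λ f → Admits (DoubleCycle ℓ r) f × Nilpotent f) ⇔ (ℓ ⊓ r) ∣ (ℓ ⊔ r))
    × (∀ f → Admits (DoubleCycle ℓ r) f → Nilpotent f →
    HasClass f (2 * (ℓ ⊔ r) ∸ 1))
theorem3 (suc l) (suc m) = equivalence , class l m
  where
  equivalence : ¬ (suc l ≡ 1 × suc m ≡ 1) →
    (∃ λ f → Admits (DoubleCycle (suc l) (suc m)) f × Nilpotent f) ⇔
    (suc l ⊓ suc m) ∣ (suc l ⊔ suc m)
  equivalence nonloop = mk⇔
    (λ (f , adm , nil) → proj₁ (admitted∧nilpotent l m nonloop′ adm nil))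
    (divides⇒admits-nilpotent l m nonloop′)
    where
    nonloop′ : ¬ (l ≡ 0 × m ≡ 0)
    nonloop′ (l≡0 , m≡0) = nonloop (cong suc l≡0 , cong suc m≡0)
  class : ∀ l m f → Admits (DoubleCycle (suc l) (suc m)) f → Nilpotent f →
    HasClass f (2 * (suc l ⊔ suc m) ∸ 1)
  class zero    zero    f adm nil = contradiction nil (loop-not-nilpotent adm)
  class zero    (suc m) f adm nil = proj₂ (admitted∧nilpotent 0 (suc m) (λ ()) adm nil)
  class (suc l) m       f adm nil = proj₂ (admitted∧nilpotent (suc l) m (λ ()) adm nil)
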